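{- There exist degree sequences $\mathbf d_1,\mathbf d_2$ such that the double hyperarc shuffling method with $k$ steps does not sample uniformly from the spaces $$\mathcal H^{\mathrm{stub}}_{s,d}(\mathbf d_1),\quad \mathcal H^{\mathrm{stub}}_{d,m}(\mathbf d_2),\quad \mathcal H^{\mathrm{stub}}_{d}(\mathbf d_2),\quad \mathcal H^{\mathrm{stub}}_{m}(\mathbf d_2),\quad\text{and}\quad \mathcal H^{\mathrm{stub}}_{\emptyset}(\mathbf d_2),$$ for any $k$.
   Context: **Directed hypergraphs.** A directed hypergraph $H=(V,A)$ consists of a vertex set $V$ and a multiset $A=A(H)$ of hyperarcs; a hyperarc is a pair $a=(a^{\mathrm t},a^{\mathrm h})$ of multisets of elements of $V$ (its tail and head). $m_s(v)$ denotes the multiplicity of $v$ in a multiset $s$, and $\uplus$ is multiset union with multiplicities added. A hyperarc $a$ is a self-loop if $a^{\mathrm t}=a^{\mathrm h}$; it is degenerate if some vertex has multiplicity at least $2$ in $a^{\mathrm t}$ or in $a^{\mathrm h}$. Two hyperarcs $a_1,a_2$ of $H$ are multi-hyperarcs if $a_1^{\mathrm t}=a_2^{\mathrm t}$ and $a_1^{\mathrm h}=a_2^{\mathrm h}$. **Degrees.** $d_v^{\mathrm{in}}=\sum_{a\in A}m_{a^{\mathrm h}}(v)$, $d_v^{\mathrm{out}}=\sum_{a\in A}m_{a^{\mathrm t}}(v)$, $\delta_a^{\mathrm t}=|a^{\mathrm t}|$, $\delta_a^{\mathrm h}=|a^{\mathrm h}|$ (cardinalities with multiplicity). The degree sequence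 is $\mathbf d=(\mathbf d_V,\boldsymbol\delta_A)$ with $\mathbf d_V=((d_v^{\mathrm{in}},d_v^{\mathrm{out}}))_{v\in V}$ and $\boldsymbol\delta_A=((\delta_a^{\mathrm t},\delta_a^{\mathrm h}))_{a\in A}$. **Stub-labeled hypergraphs.** Each vertex $v$ has $d_v^{\mathrm{out}}$ distinct out-stubs and $d_v^{\mathrm{in}}$ distinct in-stubs. In a stub-labeled directed hypergraph the tail (head) of every hyperarc is a set of out-stubs (in-stubs), every out-stub lies in exactly one tail and every in-stub in exactly one head; two stub-labeled directed hypergraphs are the same iff their sets of linked stubs are the same. Self-loops, degenerate hyperarcs and multi-hyperarcs are determined using only the vertex labels (each stub replaced by its vertex). **Spaces.** For $x\subseteq\{s,d,m\}$, $\mathcal H^{\mathrm{stub}}_x(\mathbf d)$ is the set of all stub-labeled directed hypergraphs with degree sequence $\mathbf d$ that do not contain those of the features $s$ (self-loops), $d$ (degenerate hyperarcs), $m$ (multi-hyperarcs) that are not in $x$. For instance $\mathcal H^{\mathrm{stub}}_\emptyset(\mathbf d)$ forbids all three features. **Double hyperarc shuffle.** For two distinct hyperarcs $a,b$ of $H$ (distinct elements of the multiset $A(H)$), $S(a,b)$ is the set of pairs $(\hat a,\hat b)$ with $a^{\mathrm t}\uplus b^{\mathrm t}=\hat a^{\mathrm t}\uplus\hat b^{\mathrm t}$, $a^{\mathrm h}\uplus b^{\mathrm h}=\hat a^{\mathrm h}\uplus\hat b^{\mathrm h}$, $(\delta_a^{\mathrm t},\delta_a^{\mathrm h})=(\delta_{\hat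 a}^{\mathrm t},\delta_{\hat a}^{\mathrm h})$, $(\delta_b^{\mathrm t},\delta_b^{\mathrm h})=(\delta_{\hat b}^{\mathrm t},\delta_{\hat b}^{\mathrm h})$; for stub-labeled hypergraphs tails and heads here are sets of stubs. The shuffle $s(a,b|H)$ picks $(\hat a,\hat b)\in S(a,b)$ uniformly at random and outputs $H'$ with $A(H')=(A(H)\setminus\{a,b\})\uplus\{\hat a,\hat b\}$. **Double hyperarc shuffling method with $k$ steps** on a space $\mathcal H$, given an initial directed hypergraph $H_0\in\mathcal H$: for $i=0,1,\dots,k-1$, pick a pair of distinct hyperarcs $a_i,b_i$ of $H_i$ uniformly at random, perform $s(a_i,b_i|H_i)$, and let $H_{i+1}$ be the result if it lies in $\mathcal H$, and $H_{i+1}=H_i$ otherwise. The method is a random trial with outcome $H_k$. To sample uniformly from $\mathcal H$ means that the outcome of the method on $\mathcal H$ is uniformly distributed on $\mathcal H$. -}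

module Defs where

open import Data.Nat as ℕ using (ℕ; zero; suc; _+_; _≤_; _≤?_)
open import Data.Integer using (+_)
open import Data.Rational as ℚ using (ℚ; 0ℚ; 1ℚ)
open import Data.Bool using (if_then_else_)
import Data.Bool.Properties as Bool
open import Data.Fin using (Fin; zero; suc)
open import Data.Fin.Properties as Fin using (all?; any?)
open import Data.Fin.Subset using (Subset; ∣_∣; _∩_; _∈_; _∉_; inside; outside)
open import Data.Fin.Subset.Properties using (_∈?_)
open import Data.List as List using (List; []; _∷_; _++_; length; cartesianProduct)
open import Data.List.Membership.Propositional.Properties using (∈-∃++)
import Data.List.Membership.DecPropositional as DecMembership
open import Data.List.Relation.Unary.Any using (here)
open import Data.List.Relation.Binary.Permutation.Propositional
  using (_↭_; ↭-refl; ↭-sym; ↭-trans; prep)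
open import Data.List.Relation.Binary.Permutation.Propositional.Properties
  using (shift; drop-∷; ∈-resp-↭; ¬x∷xs↭[])
open import Data.Vec as Vec using (Vec; []; _∷_; lookup; tabulate; toList; _[_]≔_)
import Data.Vec.Properties as Vec
open import Data.Product using (∃-syntax; ∃!; _×_; _,_)
open import Data.Product.Properties using (≡-dec)
open import Data.Sum using (_⊎_)
open import Function using (_∘_)
open import Relation.Nullary using (¬_; Dec; yes; no; does; map′; ¬?; _×-dec_; _⊎-dec_; _→-dec_)
open import Relation.Unary using (Pred; Decidable)
open import Relation.Binary using (DecidableEquality)
open import Relation.Binary.PropositionalEquality using (_≡_; _≢_; refl)
open import Level using (0ℓ)

-- Outcomes with their weights; the same outcome may be listed repeatedly, in
-- which case its weights add up.
Dist : Set → Set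
Dist A = List (A × ℚ)

return : ∀ {A} → A → Dist A
return x = (x , 1ℚ) ∷ []

infixl 1 _>>=_
_>>=_ : ∀ {A B} → Dist A → (A → Dist B) → Dist B
μ >>= f = List.concatMap (λ (x , p) → List.map (λ (y , q) → y , p ℚ.* q) (f x)) μ

-- Each entry of the list is equally likely.  There is no way to pick from an
-- empty list, and the result is then the empty (zero mass) distribution.
uniformly : ∀ {A} → List A → Dist A
uniformly []          = []
uniformly xs@(_ ∷ ys) = List.map (_, + 1 ℚ./ suc (length ys)) xs

Pr : ∀ {A} {P : Pred A 0ℓ} → Decidable P → Dist A → ℚ
Pr P? []            = 0ℚ
Pr P? ((x , p) ∷ μ) = (if does (P? x) then p else 0ℚ) ℚ.+ Pr P? μ

module _ {A : Set} (_≟_ : DecidableEquality A) where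
  open DecMembership _≟_ using () renaming (_∈?_ to _∈ᴸ?_)

  ↭-dec : (xs ys : List A) → Dec (xs ↭ ys)
  ↭-dec []       []       = yes ↭-refl
  ↭-dec []       (_ ∷ _)  = no (¬x∷xs↭[] ∘ ↭-sym)
  ↭-dec (x ∷ xs) ys with x ∈ᴸ? ys
  ... | no  x∉ys = no (λ eq → x∉ys (∈-resp-↭ eq (here refl)))
  ... | yes x∈ys with ∈-∃++ x∈ys
  ... | us , vs , refl =
    map′ (λ eq → ↭-trans (prep x eq) (↭-sym (shift x us vs)))
         (λ eq → drop-∷ (↭-trans eq (shift x us vs)))
         (↭-dec xs (us ++ vs))

allSubsets : ∀ n → List (Subset n)
allSubsets zero    = [] ∷ []
allSubsets (suc n) = List.map (outside ∷_) (allSubsets n) ++ List.map (inside ∷_) (allSubsets n)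

record DegreeSequence : Set where
  field
    #V : ℕ
    #A : ℕ
    inDegree outDegree : Fin #V → ℕ
    tailDegree headDegree : Fin #A → ℕ

-- The features that a space may permit; x ⊆ {s, d, m} is a Subset 3.
Feature : Set
Feature = Fin 3

pattern self-loops   = zero
pattern degenerate   = suc zero
pattern multi        = suc (suc zero)

module StubLabeled (𝐝 : DegreeSequence) where
  open DegreeSequence 𝐝

  -- Vertex v occurs (degree v) times in this list; its stubs are the positions
  -- of these occurrences.
  stubOwners : (Fin #V → ℕ) → List (Fin #V)
  stubOwners degree = List.concatMap (λ v → List.replicate (degree v) v) (List.allFin #V)

  OutStub InStub : Set
  OutStub = Fin (length (stubOwners outDegree))
  InStub  = Fin (length (stubOwners inDegree))

  outOwner : OutStub → Fin #V
  outOwner = List.lookup (stubOwners outDegree)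

  inOwner : InStub → Fin #V
  inOwner = List.lookup (stubOwners inDegree)

  record Hyperarc : Set where
    constructor _⇒_
    field
      tail : Subset (length (stubOwners outDegree))
      head : Subset (length (stubOwners inDegree))
  open Hyperarc public

  _≟ᴬ_ : DecidableEquality Hyperarc
  (t ⇒ h) ≟ᴬ (t′ ⇒ h′) =
    map′ (λ { (refl , refl) → refl }) (λ { refl → refl , refl })
         (Vec.≡-dec Bool._≟_ t t′ ×-dec Vec.≡-dec Bool._≟_ h h′)

  allHyperarcs : List Hyperarc
  allHyperarcs = List.cartesianProductWith _⇒_ (allSubsets _) (allSubsets _)

  -- A multiset of #A hyperarcs listed in some order, which _≈_ disregards.
  Hypergraph : Set
  Hypergraph = Vec Hyperarc #A

  infix 4 _≈_ _≈?_
  _≈_ : Hypergraph → Hypergraph → Set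
  H ≈ H′ = toList H ↭ toList H′

  _≈?_ : ∀ H H′ → Dec (H ≈ H′)
  H ≈? H′ = ↭-dec _≟ᴬ_ (toList H) (toList H′)

  -- Multiplicity of a vertex in the multiset obtained from a set of stubs by
  -- replacing each stub by its owner.
  mult : ∀ {n} → (Fin n → Fin #V) → Subset n → Fin #V → ℕ
  mult owner S v = ∣ S ∩ tabulate (λ i → does (owner i Fin.≟ v)) ∣

  tailMult headMult : Hyperarc → Fin #V → ℕ
  tailMult a = mult outOwner (tail a)
  headMult a = mult inOwner (head a)

  IsSelfLoop : Pred Hyperarc 0ℓ
  IsSelfLoop a = ∀ v → tailMult a v ≡ headMult a v

  IsDegenerate : Pred Hyperarc 0ℓ
  IsDegenerate a = ∃[ v ] (2 ≤ tailMult a v ⊎ 2 ≤ headMult a v)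

  Parallel : Hyperarc → Hyperarc → Set
  Parallel a b = ∀ v → tailMult a v ≡ tailMult b v × headMult a v ≡ headMult b v

  Has : Feature → Pred Hypergraph 0ℓ
  Has self-loops H = ∃[ i ] IsSelfLoop (lookup H i)
  Has degenerate H = ∃[ i ] IsDegenerate (lookup H i)
  Has multi      H = ∃[ i ] ∃[ j ] (i ≢ j × Parallel (lookup H i) (lookup H j))

  has? : ∀ f → Decidable (Has f)
  has? self-loops H = any? λ i → all? λ v → _ ℕ.≟ _
  has? degenerate H = any? λ i → any? λ v → (2 ≤? _) ⊎-dec (2 ≤? _)
  has? multi      H = any? λ i → any? λ j →
    ¬? (i Fin.≟ j) ×-dec all? (λ v → (_ ℕ.≟ _) ×-dec (_ ℕ.≟ _))

  -- The vertex degrees are realised because every stub is used exactly once.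
  record HasDegrees (H : Hypergraph) : Set where
    constructor hasDegrees
    field
      tail-size  : ∀ i → ∣ tail (lookup H i) ∣ ≡ tailDegree i
      head-size  : ∀ i → ∣ head (lookup H i) ∣ ≡ headDegree i
      out-unique : ∀ (σ : OutStub) → ∃! _≡_ λ i → σ ∈ tail (lookup H i)
      in-unique  : ∀ (σ : InStub) → ∃! _≡_ λ i → σ ∈ head (lookup H i)

  record Space (x : Subset 3) (H : Hypergraph) : Set where
    constructor space
    field
      degrees  : HasDegrees H
      features : ∀ f → f ∉ x → ¬ Has f H

  ∃!? : ∀ {n} {P : Pred (Fin n) 0ℓ} → Decidable P → Dec (∃! _≡_ P)
  ∃!? P? = map′ (λ (i , p , u) → i , p , λ {j} → u j) (λ (i , p , u) → i , p , λ j → u {j})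
    (any? λ i → P? i ×-dec all? λ j → P? j →-dec (i Fin.≟ j))

  hasDegrees? : Decidable HasDegrees
  hasDegrees? H =
    map′ (λ (a , b , c , d) → hasDegrees a b c d)
         (λ (hasDegrees a b c d) → a , b , c , d)
         (all? (λ i → _ ℕ.≟ _) ×-dec all? (λ i → _ ℕ.≟ _)
          ×-dec all? (λ σ → ∃!? λ i → σ ∈? _) ×-dec all? (λ σ → ∃!? λ i → σ ∈? _))

  space? : ∀ x → Decidable (Space x)
  space? x H =
    map′ (λ (a , b) → space a b) (λ (space a b) → a , b)
         (hasDegrees? H ×-dec all? λ f → ¬? (f ∈? x) →-dec ¬? (has? f H))

  -- Multiset union: 1 + 1 = 2 where both sets contain an element.
  infixl 6 _⊎ᵐ_
  _⊎ᵐ_ : ∀ {n} → Subset n → Subset n → Fin n → ℕ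
  (S ⊎ᵐ T) i = count S + count T
    where
    count : Subset _ → ℕ
    count U = if lookup U i then 1 else 0

  record IsShuffle (a b â b̂ : Hyperarc) : Set where
    constructor isShuffle
    field
      tails  : ∀ σ → (tail a ⊎ᵐ tail b) σ ≡ (tail â ⊎ᵐ tail b̂) σ
      heads  : ∀ σ → (head a ⊎ᵐ head b) σ ≡ (head â ⊎ᵐ head b̂) σ
      sizeᵃ  : (∣ tail a ∣ , ∣ head a ∣) ≡ (∣ tail â ∣ , ∣ head â ∣)
      sizeᵇ  : (∣ tail b ∣ , ∣ head b ∣) ≡ (∣ tail b̂ ∣ , ∣ head b̂ ∣)

  isShuffle? : ∀ a b → Decidable (λ ((â , b̂) : Hyperarc × Hyperarc) → IsShuffle a b â b̂)
  isShuffle? a b (â , b̂) =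
    map′ (λ (p , q , r , s) → isShuffle p q r s) (λ (isShuffle p q r s) → p , q , r , s)
         (all? (λ σ → _ ℕ.≟ _) ×-dec all? (λ σ → _ ℕ.≟ _)
          ×-dec ≡-dec ℕ._≟_ ℕ._≟_ _ _ ×-dec ≡-dec ℕ._≟_ ℕ._≟_ _ _)

  S : Hyperarc → Hyperarc → List (Hyperarc × Hyperarc)
  S a b = List.filter (isShuffle? a b) (cartesianProduct allHyperarcs allHyperarcs)

  shuffle : Fin #A → Fin #A → Hypergraph → Dist Hypergraph
  shuffle i j H =
    uniformly (S (lookup H i) (lookup H j)) >>= λ (â , b̂) →
    return ((H [ i ]≔ â) [ j ]≔ b̂)

  -- Ordered pairs; since S a b and S b a agree up to swapping components, an
  -- unordered choice leads to the same law of the resulting multiset.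
  distinctPairs : List (Fin #A × Fin #A)
  distinctPairs =
    List.filter (λ (i , j) → ¬? (i Fin.≟ j)) (cartesianProduct (List.allFin #A) (List.allFin #A))

  step : Subset 3 → Hypergraph → Dist Hypergraph
  step x H =
    uniformly distinctPairs >>= λ (i , j) →
    shuffle i j H >>= λ H′ →
    return (if does (space? x H′) then H′ else H)

  method : Subset 3 → ℕ → Hypergraph → Dist Hypergraph
  method x zero    H₀ = return H₀
  method x (suc k) H₀ = method x k H₀ >>= step x

  -- All elements of the space are equally likely.  (When #A < 2 no step can be
  -- performed and all probabilities vanish for k > 0; the space then has at
  -- most one element, so that this holds trivially.)
  UniformOn : Subset 3 → Dist Hypergraph → Set
  UniformOn x μ = ∀ H H′ → Space x H → Space x H′ → Pr (H ≈?_) μ ≡ Pr (H′ ≈?_) μ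

-- The space is nonempty, and from no initial element of it does the method
-- with k steps have a uniformly distributed outcome.
DoesNotSampleUniformly : DegreeSequence → Subset 3 → ℕ → Set
DoesNotSampleUniformly 𝐝 x k =
  (∃[ H₀ ] Space x H₀) × (∀ H₀ → Space x H₀ → ¬ UniformOn x (method x k H₀))
  where open StubLabeled 𝐝

-- Two elements of a space lie in different components of the shuffling chain if
-- some property invariant under shuffles within the space separates them.  From
-- any start the chain then misses one of them, yet it always has a positive
-- probability of staying put, so that its law is not uniform.  Both examples
-- have three vertices x, y, z and three hyperarcs, and the property says that
-- every hyperarc is one of those of a fixed hypergraph C:
--
--   𝐝₁: tails of size 2, empty heads, C = {xx, yy, zz}.  Shuffling xx with yy
--       yields {xx, yy} or the multi-hyperarcs xy, xy; xy, yz, zx also exists.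
--   𝐝₂: the directed 3-cycle C = {x→y, y→z, z→x}.  Shuffling x→y with y→z
--       yields {x→y, y→z} or {x→z, y→y}; the reversed cycle also exists.
{-# OPTIONS --safe #-}
module Submission where

open import Defs
open import Data.Nat using (ℕ)
open import Data.Product using (∃₂; _×_)
open import Data.Fin.Subset using (⊥; ⁅_⁆; _∪_)

open import Level using (0ℓ)
open import Data.Nat as ℕ using (zero; suc)
open import Data.Rational as ℚ using (0ℚ; Positive; NonNegative)
import Data.Rational.Properties as ℚ
open import Data.Bool using (true; false; if_then_else_)
open import Data.Bool.Properties using (if-eta; if-cong-then)
open import Data.Fin using (Fin; zero; suc)
open import Data.Fin.Properties as Fin using (all?)
open import Data.Fin.Subset using (Subset; inside; outside; _∉_)
open import Data.Fin.Subset.Properties using (_∈?_; ∉⊥)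
open import Data.List using (List; []; _∷_; length; cartesianProduct; allFin)
open import Data.List.Membership.Propositional using (_∈_)
open import Data.List.Membership.Propositional.Properties
  using (∈-filter⁺; ∈-cartesianProduct⁺; ∈-cartesianProductWith⁺; ∈-allFin; ∈-map⁺; ∈-++⁺ˡ; ∈-++⁺ʳ)
open import Data.List.Relation.Unary.All as All using (All; []; _∷_)
import Data.List.Relation.Unary.All.Properties as All
open import Data.List.Relation.Unary.Any as Any using (Any; here; there)
import Data.List.Relation.Unary.Any.Properties as Any
open import Data.List.Relation.Binary.Permutation.Propositional using (↭-refl; ↭-sym)
open import Data.List.Relation.Binary.Permutation.Propositional.Properties using (∈-resp-↭)
import Data.List.Relation.Binary.Subset.DecPropositional as SubsetOf
open import Data.Vec using ([]; _∷_; lookup; toList; _[_]≔_)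
open import Data.Vec.Properties using (lookup∘update; lookup∘update′; []≔-lookup)
import Data.Vec.Relation.Unary.Any as VecAny
open import Data.Vec.Relation.Unary.Any.Properties using (lookup-index)
open import Data.Vec.Membership.Propositional.Properties using (∈-lookup; ∈-toList⁺; ∈-toList⁻)
open import Data.Product using (_,_; proj₁; proj₂)
open import Function using (_∘_; _$_)
open import Relation.Nullary
  using (¬_; Dec; yes; no; does; map′; ¬?; _×-dec_; _→-dec_; contradiction)
open import Relation.Nullary.Decidable using (from-yes; from-no; dec-true)
open import Relation.Unary using (Pred; Decidable; ∁; _∩_)
open import Relation.Binary using (_Respects_)
open import Relation.Binary.PropositionalEquality
  using (_≡_; _≢_; refl; sym; trans; cong; subst; subst₂)

-- Finite weighted distributions: supports and positivity.

private variable
  A B : Set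
  n : ℕ

-- The sign condition travels with the property, so one induction along `_>>=_` delivers both;
-- without it, weights could cancel in `Pr`.
Supported : Pred A 0ℓ → Dist A → Set
Supported P = All λ (x , p) → P x × NonNegative p

infix 4 _∈⁺_
_∈⁺_ : A → Dist A → Set
x ∈⁺ μ = Any (λ (y , p) → x ≡ y × Positive p) μ

supported-return : ∀ {P : Pred A 0ℓ} {x} → P x → Supported P (return x)
supported-return Px = (Px , _) ∷ []

supported->>= : ∀ {P : Pred A 0ℓ} {Q : Pred B 0ℓ} μ {f} →
                Supported P μ → (∀ {x} → P x → Supported Q (f x)) → Supported Q (μ >>= f)
supported->>= _ μ-supp f-supp = All.concat⁺ (All.map⁺ (All.map
  (λ { {_ , p} (Px , p≥0) → All.map⁺ (All.map
    (λ { {_ , q} (Qy , q≥0) → Qy , ℚ.nonNeg*nonNeg⇒nonNeg p {{p≥0}} q {{q≥0}} }) (f-supp Px)) }) μ-supp))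

supported-uniformly : ∀ {P : Pred A 0ℓ} xs → All P xs → Supported P (uniformly xs)
supported-uniformly []       []            = []
supported-uniformly (_ ∷ ys) Pxs@(_ ∷ _) = All.map⁺ (All.map (_, weight≥0) Pxs)
  where weight≥0 = ℚ.normalize-nonNeg 1 (suc (length ys))

∈⁺-return : (x : A) → x ∈⁺ return x
∈⁺-return x = here (refl , _)

∈⁺->>= : ∀ {x : A} {y : B} μ {f} → x ∈⁺ μ → y ∈⁺ f x → y ∈⁺ (μ >>= f)
∈⁺->>= _ x∈μ y∈fx = Any.concat⁺ (Any.map⁺ (Any.map
  (λ { {_ , p} (refl , p>0) → Any.map⁺ (Any.map
    (λ { {_ , q} (y≡ , q>0) → y≡ , ℚ.pos*pos⇒pos p {{p>0}} q {{q>0}} }) y∈fx) }) x∈μ))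

∈⁺-uniformly : ∀ {x : A} xs → x ∈ xs → x ∈⁺ uniformly xs
∈⁺-uniformly (_ ∷ ys) x∈xs = Any.map⁺ (Any.map (_, weight>0) x∈xs)
  where weight>0 = ℚ.normalize-pos 1 (suc (length ys))

module _ {P : Pred A 0ℓ} (P? : Decidable P) where

  Pr-nonNeg : ∀ {Q : Pred A 0ℓ} {μ} → Supported Q μ → NonNegative (Pr P? μ)
  Pr-nonNeg [] = _
  Pr-nonNeg {μ = (x , p) ∷ μ} ((_ , p≥0) ∷ supp) with does (P? x)
  ... | true  = ℚ.nonNeg+nonNeg⇒nonNeg p {{p≥0}} (Pr P? μ) {{Pr-nonNeg supp}}
  ... | false = ℚ.nonNeg+nonNeg⇒nonNeg 0ℚ (Pr P? μ) {{Pr-nonNeg supp}}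

  -- One entry of positive weight suffices because `Supported` makes all other contributions
  -- nonnegative.
  Pr-pos : ∀ {Q : Pred A 0ℓ} {μ x} → Supported Q μ → P x → x ∈⁺ μ → Positive (Pr P? μ)
  Pr-pos {μ = (x , p) ∷ μ} (_ ∷ supp) Px (here (refl , p>0)) rewrite dec-true (P? x) Px =
    ℚ.pos+nonNeg⇒pos p {{p>0}} (Pr P? μ) {{Pr-nonNeg supp}}
  Pr-pos {μ = (y , p) ∷ μ} ((_ , p≥0) ∷ supp) Px (there x∈μ) with does (P? y)
  ... | true  = ℚ.nonNeg+pos⇒pos p {{p≥0}} (Pr P? μ) {{Pr-pos supp Px x∈μ}}
  ... | false = ℚ.nonNeg+pos⇒pos 0ℚ (Pr P? μ) {{Pr-pos supp Px x∈μ}}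

  Pr-zero : ∀ {μ} → Supported (∁ P) μ → Pr P? μ ≡ 0ℚ
  Pr-zero [] = refl
  Pr-zero {μ = (x , _) ∷ _} ((¬Px , _) ∷ supp) with P? x
  ... | yes Px = contradiction Px ¬Px
  ... | no  _  = trans (ℚ.+-identityˡ _) (Pr-zero supp)

if-dec : ∀ {P : Set} {Q : Pred A 0ℓ} {x y} (P? : Dec P) →
         (P → Q x) → Q y → Q (if does P? then x else y)
if-dec (yes p) Qx _  = Qx p
if-dec (no  _) _  Qy = Qy

-- Exhaustive enumeration of subsets.

∈-allSubsets : (S : Subset n) → S ∈ allSubsets n
∈-allSubsets []            = here refl
∈-allSubsets (outside ∷ S) = ∈-++⁺ˡ (∈-map⁺ (outside ∷_) (∈-allSubsets S))
∈-allSubsets (inside ∷ S)  = ∈-++⁺ʳ _ (∈-map⁺ (inside ∷_) (∈-allSubsets S))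

allSubset? : {P : Pred (Subset n) 0ℓ} → Decidable P → Dec (∀ S → P S)
allSubset? {zero}  P? = map′ (λ { P[] [] → P[] }) (_$ []) (P? [])
allSubset? {suc n} P? = map′
  (λ { (out , _) (outside ∷ S) → out S ; (_ , ins) (inside ∷ S) → ins S })
  (λ all → all ∘ (outside ∷_) , all ∘ (inside ∷_))
  (allSubset? (P? ∘ (outside ∷_)) ×-dec allSubset? (P? ∘ (inside ∷_)))

-- The shuffling chain of an arbitrary degree sequence.

module Chain (𝐝 : DegreeSequence) where
  open DegreeSequence 𝐝
  open StubLabeled 𝐝
  open SubsetOf _≟ᴬ_ using (_⊆_)

  ∈-allHyperarcs : ∀ a → a ∈ allHyperarcs
  ∈-allHyperarcs (t ⇒ h) = ∈-cartesianProductWith⁺ _⇒_ (∈-allSubsets t) (∈-allSubsets h)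

  allHyperarc? : {P : Pred Hyperarc 0ℓ} → Decidable P → Dec (∀ a → P a)
  allHyperarc? P? = map′ (λ { all (t ⇒ h) → all t h }) (λ all t h → all (t ⇒ h))
    (allSubset? λ t → allSubset? λ h → P? (t ⇒ h))

  isShuffle-refl : ∀ {a b} → IsShuffle a b a b
  isShuffle-refl = isShuffle (λ _ → refl) (λ _ → refl) refl refl

  isShuffle-sym : ∀ {a b â b̂} → IsShuffle a b â b̂ → IsShuffle â b̂ a b
  isShuffle-sym (isShuffle ts hs sᵃ sᵇ) = isShuffle (sym ∘ ts) (sym ∘ hs) (sym sᵃ) (sym sᵇ)

  S-isShuffle : ∀ a b → All (λ (â , b̂) → IsShuffle a b â b̂) (S a b)
  S-isShuffle a b = All.all-filter (isShuffle? a b) (cartesianProduct allHyperarcs allHyperarcs)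

  ∈-S : ∀ a b → (a , b) ∈ S a b
  ∈-S a b = ∈-filter⁺ (isShuffle? a b)
    (∈-cartesianProduct⁺ (∈-allHyperarcs a) (∈-allHyperarcs b)) isShuffle-refl

  distinctPairs-≢ : All (λ (i , j) → i ≢ j) distinctPairs
  distinctPairs-≢ = All.all-filter (λ (i , j) → ¬? (i Fin.≟ j))
    (cartesianProduct (allFin #A) (allFin #A))

  ∈-distinctPairs : ∀ {i j} → i ≢ j → (i , j) ∈ distinctPairs
  ∈-distinctPairs {i} {j} = ∈-filter⁺ (λ (i , j) → ¬? (i Fin.≟ j))
    (∈-cartesianProduct⁺ (∈-allFin i) (∈-allFin j))

  -- A proposed move as a relation between positions of two hypergraphs, with probabilities
  -- forgotten. In this form its symmetry is immediate.
  infix 4 _⟶_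
  record _⟶_ (H H′ : Hypergraph) : Set where
    field
      {i j}    : Fin #A
      i≢j      : i ≢ j
      shuffled : IsShuffle (lookup H i) (lookup H j) (lookup H′ i) (lookup H′ j)
      others   : ∀ l → l ≢ i → l ≢ j → lookup H l ≡ lookup H′ l

  ⟶-sym : ∀ {H H′} → H ⟶ H′ → H′ ⟶ H
  ⟶-sym s = record
    { i≢j      = i≢j
    ; shuffled = isShuffle-sym shuffled
    ; others   = λ l l≢i l≢j → sym (others l l≢i l≢j)
    }
    where open _⟶_ s

  update-⟶ : ∀ {H i j â b̂} → i ≢ j → IsShuffle (lookup H i) (lookup H j) â b̂ →
             H ⟶ (H [ i ]≔ â) [ j ]≔ b̂
  update-⟶ {H} {i} {j} {â} {b̂} i≢j s = record
    { i≢j      = i≢j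
    ; shuffled = subst₂ (IsShuffle (lookup H i) (lookup H j))
        (sym (trans (lookup∘update′ i≢j (H [ i ]≔ â) b̂) (lookup∘update i H â)))
        (sym (lookup∘update j (H [ i ]≔ â) b̂)) s
    ; others   = λ l l≢i l≢j →
        sym (trans (lookup∘update′ l≢j (H [ i ]≔ â) b̂) (lookup∘update′ l≢i H â))
    }

  -- Both ends lie in the space because a proposal outside it is rejected and leaves the state as it
  -- was.
  Invariant : Subset 3 → Pred Hypergraph 0ℓ → Set
  Invariant x I = ∀ {H H′} → Space x H → Space x H′ → H ⟶ H′ → I H → I H′

  -- Moves are reversible: a move from the complement into `I`, run backwards, would leave `I`.
  invariant-∁ : ∀ {x I} → Invariant x I → Invariant x (∁ I)
  invariant-∁ inv H∈ H′∈ s ¬IH IH′ = ¬IH (inv H′∈ H∈ (⟶-sym s) IH′)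

  module _ {x : Subset 3} where

    step-supported : ∀ {I H} → Invariant x I → (Space x ∩ I) H → Supported (Space x ∩ I) (step x H)
    step-supported {I} {H} inv (H∈ , IH) =
      supported->>= (uniformly distinctPairs)
        (supported-uniformly distinctPairs distinctPairs-≢) λ {(i , j)} i≢j →
      supported->>= (shuffle i j H) (shuffle-supported i≢j) λ s →
      supported-return (accept s)
      where
      shuffle-supported : ∀ {i j} → i ≢ j → Supported (H ⟶_) (shuffle i j H)
      shuffle-supported {i} {j} i≢j =
        supported->>= (uniformly (S (lookup H i) (lookup H j)))
          (supported-uniformly (S _ _) (S-isShuffle _ _)) λ s →
        supported-return (update-⟶ i≢j s)

      accept : ∀ {H′} → H ⟶ H′ → (Space x ∩ I) (if does (space? x H′) then H′ else H)
      accept {H′} s = if-dec {Q = Space x ∩ I} (space? x H′)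
        (λ H′∈ → H′∈ , inv H∈ H′∈ s IH) (H∈ , IH)

    method-supported : ∀ {I H} → Invariant x I → (Space x ∩ I) H →
                       ∀ k → Supported (Space x ∩ I) (method x k H)
    method-supported inv H∈ zero    = supported-return H∈
    method-supported inv H∈ (suc k) =
      supported->>= (method x k _) (method-supported inv H∈ k) (step-supported inv)

    -- The trivial pair belongs to `S a b`, so once two distinct positions exist, the chain stays
    -- put with positive probability.
    ∈⁺-step : ∀ {i j : Fin #A} → i ≢ j → ∀ H → H ∈⁺ step x H
    ∈⁺-step {i} {j} i≢j H =
      ∈⁺->>= (uniformly distinctPairs) (∈⁺-uniformly distinctPairs (∈-distinctPairs i≢j)) $
      ∈⁺->>= (shuffle i j H) {accept} H′∈⁺shuffle $
      subst (_∈⁺ accept H′) unchanged (∈⁺-return _)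
      where
      H′ = (H [ i ]≔ lookup H i) [ j ]≔ lookup H j

      accept : Hypergraph → Dist Hypergraph
      accept H″ = return (if does (space? x H″) then H″ else H)

      H′∈⁺shuffle : H′ ∈⁺ shuffle i j H
      H′∈⁺shuffle = ∈⁺->>= (uniformly (S (lookup H i) (lookup H j)))
        {λ (â , b̂) → return ((H [ i ]≔ â) [ j ]≔ b̂)}
        (∈⁺-uniformly (S _ _) (∈-S (lookup H i) (lookup H j))) (∈⁺-return _)

      H′≡H : H′ ≡ H
      H′≡H = trans (cong (_[ j ]≔ lookup H j) ([]≔-lookup H i)) ([]≔-lookup H j)

      -- The proposal equals the current state, so accepting and rejecting have the same result.
      unchanged : (if does (space? x H′) then H′ else H) ≡ H
      unchanged = trans (if-cong-then (does (space? x H′)) H′≡H) (if-eta (does (space? x H′)))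

    ∈⁺-method : ∀ {i j : Fin #A} → i ≢ j → ∀ H k → H ∈⁺ method x k H
    ∈⁺-method i≢j H zero    = ∈⁺-return H
    ∈⁺-method i≢j H (suc k) = ∈⁺->>= (method x k H) (∈⁺-method i≢j H k) (∈⁺-step i≢j H)

    -- The start `H` keeps positive probability while `C` has probability zero. As `Pr` is taken up
    -- to `_≈_`, `I` must respect reordering for all representatives of `C` to be missed.
    missed⇒nonuniform : ∀ {i j : Fin #A} {I H C} → i ≢ j → Invariant x I → I Respects _≈_ →
                        (Space x ∩ I) H → (Space x ∩ ∁ I) C →
                        ∀ k → ¬ UniformOn x (method x k H)
    missed⇒nonuniform {I = I} {H} {C} i≢j inv I-resp H∈@(H∈x , _) (C∈x , ¬IC) k uniform =
      ℚ.<-irrefl (sym Pr≡0) (ℚ.positive⁻¹ _ {{Pr-pos (H ≈?_) supp ↭-refl (∈⁺-method i≢j H k)}})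
      where
      supp : Supported (Space x ∩ I) (method x k H)
      supp = method-supported inv H∈ k

      C-missed : ∀ {G} → (Space x ∩ I) G → ¬ C ≈ G
      C-missed (_ , IG) C≈G = ¬IC (I-resp (↭-sym C≈G) IG)

      Pr≡0 : Pr (H ≈?_) (method x k H) ≡ 0ℚ
      Pr≡0 = trans (uniform H C H∈x C∈x)
        (Pr-zero (C ≈?_) (All.map (λ (G∈ , p≥0) → C-missed G∈ , p≥0) supp))

    -- Deciding `I` places any start on one side; the witness on the other side is then missed.
    disconnected⇒nonuniform : ∀ {i j : Fin #A} {I C C′} → i ≢ j →
                              Invariant x I → Decidable I → I Respects _≈_ →
                              (Space x ∩ I) C → (Space x ∩ ∁ I) C′ →
                              ∀ k → DoesNotSampleUniformly 𝐝 x k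
    disconnected⇒nonuniform {I = I} {C} {C′} i≢j inv I? I-resp C∈@(C∈x , IC) C′∈ k =
      (C , C∈x) , nonuniform
      where
      nonuniform : ∀ H → Space x H → ¬ UniformOn x (method x k H)
      nonuniform H H∈x with I? H
      ... | yes IH = missed⇒nonuniform i≢j inv I-resp (H∈x , IH) C′∈ k
      ... | no ¬IH = missed⇒nonuniform i≢j (invariant-∁ inv)
        (λ H≈H′ ¬IH IH′ → ¬IH (I-resp (↭-sym H≈H′) IH′)) (H∈x , ¬IH) (C∈x , λ ¬IC → ¬IC IC) k

  -- Invariance of having all hyperarcs in a fixed list.

  ∈-arcs : ∀ (H : Hypergraph) i → lookup H i ∈ toList H
  ∈-arcs H i = ∈-toList⁺ (∈-lookup i H)

  arcs-⊆ : ∀ {xs} (H : Hypergraph) → (∀ i → lookup H i ∈ xs) → toList H ⊆ xs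
  arcs-⊆ {xs} H H∈ a∈H = subst (_∈ xs) (sym (lookup-index a∈H′)) (H∈ (VecAny.index a∈H′))
    where a∈H′ = ∈-toList⁻ a∈H

  -- Multiplicities are ignored, but in both examples the hyperarcs of `C` partition the out-stubs,
  -- so within the space the property means `H ≈ C`.
  ArcsOf : Hypergraph → Pred Hypergraph 0ℓ
  ArcsOf C H = toList H ⊆ toList C

  ArcsOf-resp-≈ : ∀ C → ArcsOf C Respects _≈_
  ArcsOf-resp-≈ C H≈H′ H⊆C = H⊆C ∘ ∈-resp-↭ (↭-sym H≈H′)

  -- A local substitute for invariance: it mentions only pairs of hyperarcs, hence can be decided by
  -- enumeration. `Allowed` records what the target space demands of the new pair.
  ShuffleClosed : (Hyperarc → Hyperarc → Set) → List Hyperarc → Set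
  ShuffleClosed Allowed xs = All (λ a → All (λ b → ∀ â b̂ →
    IsShuffle a b â b̂ → Allowed â b̂ → â ∈ xs × b̂ ∈ xs) xs) xs

  shuffleClosed? : ∀ {Allowed} → (∀ a b → Dec (Allowed a b)) → ∀ xs → Dec (ShuffleClosed Allowed xs)
  shuffleClosed? allowed? xs = All.all? (λ a → All.all? (λ b →
    allHyperarc? λ â → allHyperarc? λ b̂ →
    isShuffle? a b (â , b̂) →-dec allowed? â b̂ →-dec (â ∈ᴬ? xs ×-dec b̂ ∈ᴬ? xs)) xs) xs
    where open import Data.List.Membership.DecPropositional _≟ᴬ_ renaming (_∈?_ to _∈ᴬ?_)

  -- Only positions `i` and `j` change, and membership of the target `H′` in the space makes the new
  -- pair `Allowed`.
  shuffleClosed⇒invariant : ∀ {x Allowed} C →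
    (∀ {H} → Space x H → ∀ {i j} → i ≢ j → Allowed (lookup H i) (lookup H j)) →
    ShuffleClosed Allowed (toList C) → Invariant x (ArcsOf C)
  shuffleClosed⇒invariant C allowed closed {H} {H′} _ H′∈ s H⊆C = arcs-⊆ H′ H′∈C
    where
    open _⟶_ s

    new : lookup H′ i ∈ toList C × lookup H′ j ∈ toList C
    new = All.lookup (All.lookup closed (H⊆C (∈-arcs H i))) (H⊆C (∈-arcs H j))
      _ _ shuffled (allowed H′∈ i≢j)

    H′∈C : ∀ l → lookup H′ l ∈ toList C
    H′∈C l with l Fin.≟ i | l Fin.≟ j
    ... | yes refl | _        = proj₁ new
    ... | no  _    | yes refl = proj₂ new
    ... | no  l≢i  | no l≢j   = subst (_∈ toList C) (others l l≢i l≢j) (H⊆C (∈-arcs H l))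

  parallel? : ∀ a b → Dec (Parallel a b)
  parallel? a b = all? λ v → (_ ℕ.≟ _) ×-dec (_ ℕ.≟ _)

  selfLoop? : Decidable IsSelfLoop
  selfLoop? a = all? λ v → _ ℕ.≟ _

-- First example: three degenerate hyperarcs, multi-hyperarcs forbidden.

module Loops where

  𝐝₁ : DegreeSequence
  𝐝₁ = record
    { #V = 3 ; #A = 3
    ; inDegree   = λ _ → 0 ; outDegree  = λ _ → 2
    ; tailDegree = λ _ → 2 ; headDegree = λ _ → 0
    }

  open StubLabeled 𝐝₁
  open Chain 𝐝₁
  open SubsetOf _≟ᴬ_ using (_⊆?_)

  -- The head is `[]` because all in-degrees vanish and there are no in-stubs.
  edge : OutStub → OutStub → Hyperarc
  edge σ τ = (⁅ σ ⁆ ∪ ⁅ τ ⁆) ⇒ []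

  -- The stubs 2v and 2v + 1 belong to vertex v.
  pattern x₁ = zero
  pattern x₂ = suc x₁
  pattern y₁ = suc x₂
  pattern y₂ = suc y₁
  pattern z₁ = suc y₂
  pattern z₂ = suc z₁

  loops triangle : Hypergraph
  loops    = edge x₁ x₂ ∷ edge y₁ y₂ ∷ edge z₁ z₂ ∷ []
  triangle = edge x₁ y₁ ∷ edge y₂ z₁ ∷ edge z₂ x₂ ∷ []

  x : Subset 3
  x = ⁅ self-loops ⁆ ∪ ⁅ degenerate ⁆

  Allowed : Hyperarc → Hyperarc → Set
  Allowed a b = ¬ Parallel a b

  allowed : ∀ {H} → Space x H → ∀ {i j} → i ≢ j → Allowed (lookup H i) (lookup H j)
  allowed H∈ i≢j par = Space.features H∈ multi (from-no (multi ∈? x)) (_ , _ , i≢j , par)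

  -- A finite check: nine ordered pairs, each against all pairs from the 64 hyperarcs.
  loops-closed : ShuffleClosed Allowed (toList loops)
  loops-closed = from-yes (shuffleClosed? (λ a b → ¬? (parallel? a b)) (toList loops))

  nonuniform : ∀ k → DoesNotSampleUniformly 𝐝₁ x k
  nonuniform = disconnected⇒nonuniform {i = zero} {suc zero} (λ ())
    (shuffleClosed⇒invariant loops allowed loops-closed)
    (λ H → toList H ⊆? toList loops)
    (ArcsOf-resp-≈ loops)
    (from-yes (space? x loops) , λ a∈ → a∈)
    (from-yes (space? x triangle) , from-no (toList triangle ⊆? toList loops))

-- Second example: two orientations of a 3-cycle, self-loops forbidden.

module Cycles where

  𝐝₂ : DegreeSequence
  𝐝₂ = record
    { #V = 3 ; #A = 3
    ; inDegree   = λ _ → 1 ; outDegree  = λ _ → 1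
    ; tailDegree = λ _ → 1 ; headDegree = λ _ → 1
    }

  open StubLabeled 𝐝₂
  open Chain 𝐝₂
  open SubsetOf _≟ᴬ_ using (_⊆?_)

  infix 6 _↦_
  _↦_ : OutStub → InStub → Hyperarc
  σ ↦ τ = ⁅ σ ⁆ ⇒ ⁅ τ ⁆

  -- Each vertex owns one out-stub and one in-stub, so the same patterns name stubs of both kinds.
  pattern x = zero
  pattern y = suc x
  pattern z = suc y

  cycle reversed : Hypergraph
  cycle    = x ↦ y ∷ y ↦ z ∷ z ↦ x ∷ []
  reversed = y ↦ x ∷ z ↦ y ∷ x ↦ z ∷ []

  Allowed : Hyperarc → Hyperarc → Set
  Allowed a b = ¬ IsSelfLoop a × ¬ IsSelfLoop b

  -- Any two distinct arcs of a 3-cycle are consecutive, so exchanging their heads creates a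
  -- self-loop at the shared vertex.
  cycle-closed : ShuffleClosed Allowed (toList cycle)
  cycle-closed = from-yes
    (shuffleClosed? (λ a b → ¬? (selfLoop? a) ×-dec ¬? (selfLoop? b)) (toList cycle))

  -- Both cycles avoid all three features, so one computation serves every choice of `X`, and
  -- thereby all four spaces over `𝐝₂`.
  featureless : ∀ X H → HasDegrees H → (∀ f → ¬ Has f H) → Space X H
  featureless X H degrees none = space degrees λ f _ → none f

  nonuniform : ∀ X → self-loops ∉ X → ∀ k → DoesNotSampleUniformly 𝐝₂ X k
  nonuniform X s∉X = disconnected⇒nonuniform {i = zero} {suc zero} (λ ())
    (shuffleClosed⇒invariant cycle allowed cycle-closed)
    (λ H → toList H ⊆? toList cycle)
    (ArcsOf-resp-≈ cycle)
    ( featureless X cycle (from-yes (hasDegrees? cycle)) (from-yes (all? λ f → ¬? (has? f cycle)))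
    , λ a∈ → a∈)
    ( featureless X reversed (from-yes (hasDegrees? reversed))
        (from-yes (all? λ f → ¬? (has? f reversed)))
    , from-no (toList reversed ⊆? toList cycle))
    where
    allowed : ∀ {H} → Space X H → ∀ {i j} → i ≢ j → Allowed (lookup H i) (lookup H j)
    allowed H∈ _ = loopless ∘ (_ ,_) , loopless ∘ (_ ,_)
      where loopless = Space.features H∈ self-loops s∉X

theorem3 : ∃₂ λ (𝐝₁ 𝐝₂ : DegreeSequence) → ∀ (k : ℕ) →
    DoesNotSampleUniformly 𝐝₁ (⁅ self-loops ⁆ ∪ ⁅ degenerate ⁆) k
    × DoesNotSampleUniformly 𝐝₂ (⁅ degenerate ⁆ ∪ ⁅ multi ⁆) k
    × DoesNotSampleUniformly 𝐝₂ ⁅ degenerate ⁆ k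
    × DoesNotSampleUniformly 𝐝₂ ⁅ multi ⁆ k
    × DoesNotSampleUniformly 𝐝₂ ⊥ k
theorem3 = Loops.𝐝₁ , Cycles.𝐝₂ , λ k →
    Loops.nonuniform k
  , Cycles.nonuniform _ (λ ()) k
  , Cycles.nonuniform _ (λ ()) k
  , Cycles.nonuniform _ (λ ()) k
  , Cycles.nonuniform _ ∉⊥ k
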